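{- Let $\gamma$ be a composition of $n$. The map $\mathfrak c_\gamma$ is a crystal isomorphism $$B(1)\otimes\cdots\otimes B(1)\;(n\text{ factors})\;\cong\;\mathcal B^\dagger(\gamma),$$ that is, a weight-preserving bijection with $\mathfrak c_\gamma(\tilde e_i(b))=e_i^\dagger(\mathfrak c_\gamma(b))$ for all $b$ and all $i$ (with $\mathfrak c_\gamma(0)=0$). Moreover, for each partition $\mu$ of $n$, the set of highest weight elements of $\mathcal B^\dagger(\gamma)$ of weight $\mu$ is $$\{T\in\mathcal{CT}(\mu,\gamma): \text{the entries of } T \text{ strictly increase up columns in prismatic order}\}.$$
   Context: Compositions are finite sequences of non-negative integers, up to trailing zeros. The shape of $\gamma$ is the set of cells $(r,c)$, $1\le c\le\gamma_r$, rows counted upward from the bottom, columns from left to right. Reading order of cells: from the highest row down to the lowest, left to right within each row. Words. $B(1)^n=B(1)\otimes\cdots\otimes B(1)$ is the set of words $b$ of length $n$ in the alphabet $[n]=\{1,\dots,n\}$, with $\mathrm{wt}(b)=\prod_j x_{b_j}$. For $1\le i\le n-1$: in the subword of letters $i,i+1$ regard each $i+1$ as "(" and each $i$ as ")" and match parentheses as usual; the unmatched letters form $i^p(i+1)^q$. $\tilde e_i(b)=0$ if $q=0$, otherwise $\tilde e_i(b)$ replaces the unmatched subword by $i^{p+1}(i+1)^{q-1}$; $\tilde f_i(b)=0$ if $p=0$, otherwise $\tilde f_i(b)$ replaces it by $i^{p-1}(i+1)^{q+1}$. Colored tabloids. Colored letters $x_y$ are positive integers $x$ with positive integer subscripts $y$.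 Prismatic order: $u_v>r_c$ iff $r<u$, or $r=u$ and $c>v$. $\mathcal{CT}(\delta,\gamma)$ is the set of fillings of the shape $\delta$ by the colored letters $x_y$, $1\le y\le\gamma_x$, each used once, with rows increasing from left to right in prismatic order; $\mathcal{CT}(\cdot,\gamma)$ is the union over all compositions $\delta=(\delta_1,\dots,\delta_n)$ of $n$ (zero parts allowed). The map $\mathfrak c_\gamma$. For $b\in B(1)^n$ let $f_b$ be the filling of shape $\gamma$ whose entries, listed in reading order, form $b$. $\mathfrak c_\gamma(b)$ is the colored tabloid obtained by placing, for each cell $(r,c)$ of $\gamma$ with entry $e$ in $f_b$, the colored letter $r_c$ in row $e$, each row being then sorted increasingly. The graph $\mathcal B^\dagger(\gamma)$. Its vertex set is $\mathcal{CT}(\cdot,\gamma)$, with $\mathrm{wt}(T)=x^{\mathrm{shape}(T)}$. For $1\le i\le n-1$, the $i$-inflation of $T$ respaces row $i$ as follows: the entries $e$ of row $i$ are taken from left to right, and each is placed in the leftmost empty cell of row $i$ that does not have an entry $e'<e$ of row $i+1$ directly above it (row $i+1$ is left-justified and unchanged). $e_i^\dagger(T)$ is obtained by taking the largest entry of row $i+1$ lying immediately above an empty cell in the $i$-inflation, moving it down into that empty cell, and then removing all empty cells (left-justifying rows); $e_i^\dagger(T)=0$ if no entry of row $i+1$ lies above an empty cell. There is an $i$-colored edge $T\to T'$ when $e_i^\dagger(T)=T'$. A highest weight element is a vertex annihilated by $e_i^\dagger$ for all $i$; it has weight $\mu$ when its wt is $x^\mu$. -}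

module Defs where

open import Data.Empty using (⊥-elim)
open import Data.Fin.Base as Fin using (Fin; zero; suc; inject₁; toℕ)
open import Data.Fin.Properties as Fin using ()
open import Data.List.Base as List
  using (List; []; _∷_; _++_; length; map; foldl; filter; zip; mapMaybe; upTo; allFin; reverse; replicate)
open import Data.List.Properties using (length-++; length-map; length-upTo)
open import Data.List.Membership.Propositional using (_∈_)
open import Data.List.Membership.Propositional.Properties using (∈-++⁻; ∈-map⁻)
open import Data.List.Relation.Binary.Permutation.Propositional
  using (_↭_; refl; prep; ↭-refl; ↭-sym; ↭-trans; ↭-reflexive; ↭⇒↭ₛ; module PermutationReasoning)
open import Data.List.Relation.Binary.Permutation.Propositional.Properties
  using (++⁺; ++⁺ˡ; ++⁺ʳ; ++-comm; shift; All-resp-↭)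
import Data.List.Relation.Binary.Permutation.Setoid.Properties as Permutationₛ
open import Data.List.Relation.Unary.All as All using (All; []; _∷_)
import Data.List.Relation.Unary.All.Properties as All
open import Data.List.Relation.Unary.AllPairs as AllPairs using (AllPairs; []; _∷_)
import Data.List.Relation.Unary.AllPairs.Properties as AllPairs
open import Data.List.Relation.Unary.Linked using (Linked)
open import Data.List.Relation.Unary.Linked.Properties using (AllPairs⇒Linked; Linked⇒AllPairs)
open import Data.List.Relation.Unary.Unique.Propositional using (Unique)
import Data.List.Relation.Unary.Unique.Propositional.Properties as Unique
open import Data.Maybe.Base as Maybe using (Maybe; just; nothing)
open import Data.Maybe.Relation.Unary.All as MaybeAll using (just; nothing)
open import Data.Nat.Base as ℕ using (ℕ; zero; suc; pred; _+_)
open import Data.Nat.ListAction using (sum)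
open import Data.Nat.Properties as ℕ using ()
open import Data.Product.Base using (_×_; _,_; proj₁; proj₂)
open import Data.Product.Properties using (≡-dec)
open import Data.Product.Relation.Binary.Lex.Strict using (×-Lex; ×-transitive; ×-compare)
open import Data.Sum.Base using (inj₁; inj₂)
open import Data.These using (These; this; that; these; fromThis; fromThat)
open import Data.Vec.Base as Vec using (Vec; []; _∷_; lookup; tabulate; toList; _[_]≔_)
open import Data.Vec.Properties using (lookup∘tabulate; length-toList; lookup∘updateAt; lookup∘updateAt′)
import Data.Vec.Relation.Unary.Linked as VecLinked
open import Function.Base using (_∘_; _on_)
open import Relation.Binary.Bundles using (StrictTotalOrder)
open import Relation.Binary.Consequences using (tri⇒dec<)
open import Relation.Binary.Core using (Rel)
open import Relation.Binary.Definitions using (Transitive; Trichotomous; Decidable; DecidableEquality; tri<; tri≈; tri>)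
open import Relation.Binary.PropositionalEquality
  using (_≡_; _≢_; refl; sym; trans; cong; cong₂; subst; isEquivalence; setoid)
open import Relation.Binary.Structures.Biased using (isStrictTotalOrderᶜ)
import Relation.Binary.Properties.StrictTotalOrder as StrictTotalOrderProperties
import Data.List.Extrema as Extrema
import Data.List.Sort as Sort
open import Relation.Nullary.Decidable.Core using (yes; no)
open import Relation.Nullary.Negation.Core using (¬_)

private
  variable
    n : ℕ

-- A representative of a composition of n; trailing zeros may be present.

record Composition (n : ℕ) : Set where
  field
    parts : List ℕ
    total : sum parts ≡ n

-- A partition of n has at most n nonzero parts, so, trailing zeros being
-- immaterial, it is a weakly decreasing sequence of length exactly n.

record Partition (n : ℕ) : Set where
  field
    parts      : Vec ℕ n
    decreasing : VecLinked.Linked ℕ._≥_ parts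
    total      : Vec.sum parts ≡ n

-- The pair (r , c), with r and c counted from 1.

Cell : Set
Cell = ℕ × ℕ

rowCells : ℕ → ℕ → List Cell
rowCells r g = map (λ c → r , suc c) (upTo g)

-- The cells of rows r, r + 1, ... having the given lengths, in reading order.

cellsFrom : ℕ → List ℕ → List Cell
cellsFrom r []      = []
cellsFrom r (g ∷ γ) = cellsFrom (suc r) γ ++ rowCells r g

cells : List ℕ → List Cell
cells = cellsFrom 1

-- The letter i of [n] is the element i - 1 of Fin n.

Word : ℕ → Set
Word n = Vec (Fin n) n

-- A monomial in x₁, …, xₙ is given by its exponent vector.

Monomial : ℕ → Set
Monomial n = Vec ℕ n

wtʷ : Word n → Monomial n
wtʷ b = tabulate λ i → Vec.count (Fin._≟ i) b

-- An index 1 ≤ i ≤ n - 1 is an element of Fin (pred n); as elements of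
-- Fin n, the numbers i and i + 1 are then low i and high i.

low high : Fin (pred n) → Fin n
low  {suc n} i = inject₁ i
high {suc n} i = suc i

-- Parenthesis matching, i + 1 being "(" and i being ")".  The state
-- consists of the positions of the unmatched ")" and of the currently
-- unmatched "(", each list having its rightmost position first.

scan : Fin (pred n) → Word n →
       List (Fin n) × List (Fin n) → Fin n → List (Fin n) × List (Fin n)
scan i b (closes , opens) k with lookup b k Fin.≟ high i | lookup b k Fin.≟ low i
... | yes _ | _     = closes , k ∷ opens
... | no  _ | no  _ = closes , opens
... | no  _ | yes _ with opens
...   | []         = k ∷ closes , []
...   | _ ∷ opens′ = closes , opens′

unmatched : Fin (pred n) → Word n → List (Fin n) × List (Fin n)
unmatched {n} i b with foldl (scan i b) ([] , []) (allFin n)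
... | closes , opens = reverse closes , reverse opens

-- The unmatched subword iᵖ(i + 1)^q is rewritten in place.

overwrite : List (Fin n × Fin n) → Word n → Word n
overwrite kxs b = foldl (λ b′ (k , x) → b′ [ k ]≔ x) b kxs

ẽ : Fin (pred n) → Word n → Maybe (Word n)
ẽ i b with unmatched i b
... | closes , opens with length closes | length opens
...   | p | zero  = nothing
...   | p | suc q = just (overwrite (zip (closes ++ opens) subword) b)
  where subword = replicate (suc p) (low i) ++ replicate q (high i)

-- The colored letter x with subscript y is the pair (x , y).

ColoredLetter : Set
ColoredLetter = ℕ × ℕ

_≟ᶜ_ : DecidableEquality ColoredLetter
_≟ᶜ_ = ≡-dec ℕ._≟_ ℕ._≟_

infix 4 _≺_ _≺?_ _≟ᶜ_

-- Prismatic order.  Smaller subscripts make larger letters.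

_≺_ : Rel ColoredLetter _
_≺_ = ×-Lex _≡_ ℕ._<_ ℕ._>_

≺-trans : Transitive _≺_
≺-trans {x} {y} {z} = ×-transitive {_<₂_ = ℕ._>_} isEquivalence ℕ.<-resp₂-≡ ℕ.<-trans
  (λ j<i k<j → ℕ.<-trans k<j j<i) {x} {y} {z}

≺-compare : Trichotomous _≡_ _≺_
≺-compare x y with ×-compare sym ℕ.<-cmp >-cmp x y
  where
  >-cmp : Trichotomous _≡_ ℕ._>_
  >-cmp m n with ℕ.<-cmp m n
  ... | tri< a b c = tri> c b a
  ... | tri≈ a b c = tri≈ c b a
  ... | tri> a b c = tri< c b a
... | tri< a b c = tri< a (λ { refl → b (refl , refl) }) c
... | tri≈ a (refl , refl) c = tri≈ a refl c
... | tri> a b c = tri> a (λ { refl → b (refl , refl) }) c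

_≺?_ : Decidable _≺_
_≺?_ = tri⇒dec< ≺-compare

≺-strictTotalOrder : StrictTotalOrder _ _ _
≺-strictTotalOrder = record
  { isStrictTotalOrder = isStrictTotalOrderᶜ record
    { isEquivalence = isEquivalence ; trans = ≺-trans ; compare = ≺-compare } }

module ≼ = StrictTotalOrderProperties ≺-strictTotalOrder
open Sort ≼.decTotalOrder public using (sort; sort-↭; sort-↗)
open Extrema ≼.totalOrder using (max)

-- Row 1 (the bottom row) comes first; entries are listed left to right.

Filling : ℕ → Set
Filling n = Vec (List ColoredLetter) n

entries : Filling n → List ColoredLetter
entries = List.concat ∘ toList

record IsTabloid (γ : Composition n) (rows : Filling n) : Set where
  field
    increasing : ∀ i → Linked _≺_ (lookup rows i)
    -- The colored letters x_y with 1 ≤ y ≤ γₓ are the pairs in cells γ.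
    content    : entries rows ↭ cells (Composition.parts γ)

record CT (γ : Composition n) : Set where
  constructor mkCT
  field
    rows      : Filling n
    isTabloid : IsTabloid γ rows
  open IsTabloid isTabloid public
open CT public using (rows)

-- Tabloids are equal when they are the same filling.

infix 4 _≈_
_≈_ : {γ : Composition n} → Rel (CT γ) _
_≈_ = _≡_ on rows

shape : {γ : Composition n} → CT γ → Vec ℕ n
shape = Vec.map length ∘ rows

wt : {γ : Composition n} → CT γ → Monomial n
wt = shape

ColumnsIncrease : {γ : Composition n} → CT γ → Set
ColumnsIncrease {n} T = ∀ {r r′ : Fin n} → r Fin.< r′ →
  (c  : Fin (length (lookup (rows T) r))) →
  (c′ : Fin (length (lookup (rows T) r′))) → toℕ c ≡ toℕ c′ →
  List.lookup (lookup (rows T) r) c ≺ List.lookup (lookup (rows T) r′) c′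

-- The filling f_b, as the list of cells with their entries.

fill : Composition n → Word n → List (Cell × Fin n)
fill γ b = zip (cells (Composition.parts γ)) (toList b)

-- The cells (r , c) with entry e; they are also the letters r_c.

cellsWith : Fin n → List (Cell × Fin n) → List Cell
cellsWith e = map proj₁ ∘ filter (λ (_ , e′) → e′ Fin.≟ e)

𝔠-rows : Composition n → Word n → Filling n
𝔠-rows γ b = tabulate λ e → sort (cellsWith e (fill γ b))

module 𝔠-WellDefined where

  cellsFrom-length : ∀ r γ → length (cellsFrom r γ) ≡ sum γ
  cellsFrom-length r []      = refl
  cellsFrom-length r (g ∷ γ) = trans (length-++ (cellsFrom (suc r) γ))
    (trans (cong₂ _+_ (cellsFrom-length (suc r) γ)
                      (trans (length-map _ (upTo g)) (length-upTo g)))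
           (ℕ.+-comm (sum γ) g))

  cellsFrom-≥ : ∀ r γ {x} → x ∈ cellsFrom r γ → r ℕ.≤ proj₁ x
  cellsFrom-≥ r (g ∷ γ) x∈ with ∈-++⁻ (cellsFrom (suc r) γ) x∈
  ... | inj₁ x∈γ = ℕ.<⇒≤ (cellsFrom-≥ (suc r) γ x∈γ)
  ... | inj₂ x∈g with ∈-map⁻ _ x∈g
  ...   | _ , _ , refl = ℕ.≤-refl

  cellsFrom-unique : ∀ r γ → Unique (cellsFrom r γ)
  cellsFrom-unique r []      = []
  cellsFrom-unique r (g ∷ γ) = Unique.++⁺ (cellsFrom-unique (suc r) γ)
    (Unique.map⁺ (λ { refl → refl }) (Unique.upTo⁺ g)) disjoint
    where
    disjoint : ∀ {x} → ¬ (x ∈ cellsFrom (suc r) γ × x ∈ rowCells r g)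
    disjoint (x∈γ , x∈g) with ∈-map⁻ _ x∈g
    ... | _ , _ , refl = ℕ.<-irrefl refl (cellsFrom-≥ (suc r) γ x∈γ)

  map-proj₁-zip : {A B : Set} (xs : List A) (ys : List B) →
                  length xs ≡ length ys → map proj₁ (zip xs ys) ≡ xs
  map-proj₁-zip []       []       eq = refl
  map-proj₁-zip (x ∷ xs) (y ∷ ys) eq = cong (x ∷_) (map-proj₁-zip xs ys (ℕ.suc-injective eq))

  map-proj₁-fill : (γ : Composition n) (b : Word n) →
                   map proj₁ (fill γ b) ≡ cells (Composition.parts γ)
  map-proj₁-fill γ b = map-proj₁-zip _ (toList b)
    (trans (cellsFrom-length 1 (Composition.parts γ))
           (trans (Composition.total γ) (sym (length-toList b))))

  fill-unique : (γ : Composition n) (b : Word n) → Unique (map proj₁ (fill γ b))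
  fill-unique γ b = subst Unique (sym (map-proj₁-fill γ b)) (cellsFrom-unique 1 (Composition.parts γ))

  cellsWith-unique : ∀ e (zs : List (Cell × Fin n)) → Unique (map proj₁ zs) → Unique (cellsWith e zs)
  cellsWith-unique e zs = AllPairs.map⁺ ∘ AllPairs.filter⁺ _ ∘ AllPairs.map⁻

  sort-increasing : ∀ {xs} → Unique xs → Linked _≺_ (sort xs)
  sort-increasing {xs} u = AllPairs⇒Linked (AllPairs.zipWith strict
    ( Linked⇒AllPairs ≼.trans (sort-↗ xs)
    , Permutationₛ.Unique-resp-↭ (setoid _) (↭⇒↭ₛ (↭-sym (sort-↭ xs))) u))
    where
    strict : ∀ {x y} → x ≼.≤ y × x ≢ y → x ≺ y
    strict (inj₁ x≺y , _)   = x≺y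
    strict (inj₂ x≡y , x≢y) = ⊥-elim (x≢y x≡y)

  entries-cong : (f g : Fin n → List ColoredLetter) → (∀ e → f e ↭ g e) →
                 entries (tabulate f) ↭ entries (tabulate g)
  entries-cong {zero}  f g f↭g = refl
  entries-cong {suc n} f g f↭g = ++⁺ (f↭g zero) (entries-cong (f ∘ suc) (g ∘ suc) (f↭g ∘ suc))

  entries-[] : ∀ n → entries (tabulate {n = n} λ _ → []) ≡ []
  entries-[] zero    = refl
  entries-[] (suc n) = entries-[] n

  entries-∷ : (f g : Fin n → List ColoredLetter) → ∀ x e → f e ≡ x ∷ g e →
              (∀ e′ → e ≢ e′ → f e′ ≡ g e′) →
              entries (tabulate f) ↭ x ∷ entries (tabulate g)
  entries-∷ f g x zero eq neq =
    ++⁺ (↭-reflexive eq)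
        (entries-cong (f ∘ suc) (g ∘ suc) λ e → ↭-reflexive (neq (suc e) λ ()))
  entries-∷ f g x (suc e) eq neq = begin
    f zero ++ entries (tabulate (f ∘ suc))      ↭⟨ ++⁺ (↭-reflexive (neq zero λ ())) ih ⟩
    g zero ++ x ∷ entries (tabulate (g ∘ suc))  ↭⟨ shift x (g zero) _ ⟩
    x ∷ g zero ++ entries (tabulate (g ∘ suc))  ∎
    where
    open PermutationReasoning
    ih = entries-∷ (f ∘ suc) (g ∘ suc) x e eq λ e′ e≢e′ → neq (suc e′) (e≢e′ ∘ Fin.suc-injective)

  cellsWith-↭ : (zs : List (Cell × Fin n)) →
                entries (tabulate λ e → cellsWith e zs) ↭ map proj₁ zs
  cellsWith-↭ {n} []             = ↭-reflexive (entries-[] n)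
  cellsWith-↭     ((x , e) ∷ zs) =
    ↭-trans (entries-∷ _ (λ e′ → cellsWith e′ zs) x e hit miss) (prep x (cellsWith-↭ zs))
    where
    hit : cellsWith e ((x , e) ∷ zs) ≡ x ∷ cellsWith e zs
    hit with e Fin.≟ e
    ... | yes _   = refl
    ... | no  e≢e = ⊥-elim (e≢e refl)
    miss : ∀ e′ → e ≢ e′ → cellsWith e′ ((x , e) ∷ zs) ≡ cellsWith e′ zs
    miss e′ e≢e′ with e Fin.≟ e′
    ... | yes e≡e′ = ⊥-elim (e≢e′ e≡e′)
    ... | no  _    = refl

open 𝔠-WellDefined

𝔠-isTabloid : (γ : Composition n) (b : Word n) → IsTabloid γ (𝔠-rows γ b)
𝔠-isTabloid γ b = record
  { increasing = λ e → subst (Linked _≺_) (sym (lookup∘tabulate _ e))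
      (sort-increasing (cellsWith-unique e (fill γ b) (fill-unique γ b)))
  ; content = ↭-trans
      (entries-cong _ (λ e → cellsWith e (fill γ b)) λ e → sort-↭ (cellsWith e (fill γ b)))
      (↭-trans (cellsWith-↭ (fill γ b)) (↭-reflexive (map-proj₁-fill γ b)))
  }

𝔠 : (γ : Composition n) → Word n → CT γ
𝔠 γ b = mkCT (𝔠-rows γ b) (𝔠-isTabloid γ b)

-- Rows i + 1 and i of a diagram, column by column: `this a` is an entry a
-- above an empty cell, `that e` an entry e below an empty cell, and
-- `these a e` an entry a above an entry e.

Columns : Set
Columns = List (These ColoredLetter ColoredLetter)

upper lower : Columns → List ColoredLetter
upper = mapMaybe fromThis
lower = mapMaybe fromThat

-- Place e in the leftmost empty cell of the lower row with no smaller
-- entry directly above it.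

place : Columns → ColoredLetter → Columns
place []               e = that e ∷ []
place (that y    ∷ cs) e = that y ∷ place cs e
place (these a y ∷ cs) e = these a y ∷ place cs e
place (this a    ∷ cs) e with a ≺? e
... | yes _ = this a ∷ place cs e
... | no  _ = these a e ∷ cs

inflate : (above row : List ColoredLetter) → Columns
inflate above row = foldl place (map this above) row

inflation : {γ : Composition n} → Fin (pred n) → CT γ → Columns
inflation i T = inflate (lookup (rows T) (high i)) (lookup (rows T) (low i))

overEmpty : These ColoredLetter ColoredLetter → Maybe ColoredLetter
overEmpty (this a)    = just a
overEmpty (that _)    = nothing
overEmpty (these _ _) = nothing

largest : List ColoredLetter → Maybe ColoredLetter
largest []       = nothing
largest (x ∷ xs) = just (max x xs)

moveDown : ColoredLetter → These ColoredLetter ColoredLetter → These ColoredLetter ColoredLetter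
moveDown x (that y)    = that y
moveDown x (these a y) = these a y
moveDown x (this a) with a ≟ᶜ x
... | yes _ = that a
... | no  _ = this a

-- Taking `upper` and `lower` removes the empty cells.

moveDown-rows : {γ : Composition n} → Fin (pred n) → ColoredLetter → CT γ → Filling n
moveDown-rows i x T = rows T [ low i ]≔ lower cs [ high i ]≔ upper cs
  where cs = map (moveDown x) (inflation i T)

module e†-WellDefined where

  -- The columns of an inflation are related pairwise, from left to right,
  -- by the following relation.

  Ordered : Rel (These ColoredLetter ColoredLetter) _
  Ordered (this a)    (this b)    = a ≺ b
  Ordered (this a)    (that z)    = a ≺ z
  Ordered (this a)    (these b z) = a ≺ b × a ≺ z
  Ordered (that y)    (this b)    = y ≺ b
  Ordered (that y)    (that z)    = y ≺ z
  Ordered (that y)    (these b z) = y ≺ b × y ≺ z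
  Ordered (these a y) (this b)    = a ≺ b × y ≺ b
  Ordered (these a y) (that z)    = y ≺ z
  Ordered (these a y) (these b z) = a ≺ b × y ≺ b × y ≺ z

  place-All : ∀ {P : These ColoredLetter ColoredLetter → Set} {e} →
              P (that e) → (∀ a → P (this a) → P (these a e)) →
              ∀ cs → All P cs → All P (place cs e)
  place-All pe pt []               []         = pe ∷ []
  place-All pe pt (that y ∷ cs)    (pc ∷ pcs) = pc ∷ place-All pe pt cs pcs
  place-All pe pt (these a y ∷ cs) (pc ∷ pcs) = pc ∷ place-All pe pt cs pcs
  place-All {e = e} pe pt (this a ∷ cs) (pc ∷ pcs) with a ≺? e
  ... | yes _ = pc ∷ place-All pe pt cs pcs
  ... | no  _ = pt a pc ∷ pcs

  place-below : ∀ {a e} cs → ¬ a ≺ e → All (_≺ e) (lower cs) →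
                All (Ordered (this a)) cs → All (Ordered (these a e)) cs
  place-below [] a⊀e [] [] = []
  place-below {a} {e} (this b ∷ cs) a⊀e l (a≺b ∷ o) =
    (a≺b , e≺b) ∷ place-below cs a⊀e l o
    where
    e≺b : e ≺ b
    e≺b with ≺-compare a e
    ... | tri< a≺e _ _    = ⊥-elim (a⊀e a≺e)
    ... | tri≈ _ refl _   = a≺b
    ... | tri> _ _ e≺a    = ≺-trans e≺a a≺b
  place-below (that z ∷ cs) a⊀e (z≺e ∷ l) (a≺z ∷ o) = ⊥-elim (a⊀e (≺-trans a≺z z≺e))
  place-below (these b z ∷ cs) a⊀e (z≺e ∷ l) ((_ , a≺z) ∷ o) = ⊥-elim (a⊀e (≺-trans a≺z z≺e))

  place-Ordered : ∀ e cs → AllPairs Ordered cs → All (_≺ e) (lower cs) →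
                  AllPairs Ordered (place cs e)
  place-Ordered e [] [] [] = [] ∷ []
  place-Ordered e (that y ∷ cs) (o ∷ os) (y≺e ∷ l) =
    place-All y≺e (λ _ y≺a → y≺a , y≺e) cs o ∷ place-Ordered e cs os l
  place-Ordered e (these a y ∷ cs) (o ∷ os) (y≺e ∷ l) =
    place-All y≺e (λ _ (a≺b , y≺b) → a≺b , y≺b , y≺e) cs o ∷ place-Ordered e cs os l
  place-Ordered e (this a ∷ cs) (o ∷ os) l with a ≺? e
  ... | yes a≺e = place-All a≺e (λ _ a≺b → a≺b , a≺e) cs o ∷ place-Ordered e cs os l
  ... | no  a⊀e = place-below cs a⊀e l o ∷ os

  place-upper : ∀ cs e → upper (place cs e) ≡ upper cs
  place-upper []               e = refl
  place-upper (that y    ∷ cs) e = place-upper cs e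
  place-upper (these a y ∷ cs) e = cong (a ∷_) (place-upper cs e)
  place-upper (this a    ∷ cs) e with a ≺? e
  ... | yes _ = cong (a ∷_) (place-upper cs e)
  ... | no  _ = refl

  place-lower : ∀ cs e → lower (place cs e) ↭ e ∷ lower cs
  place-lower []               e = refl
  place-lower (that y    ∷ cs) e = ↭-trans (prep y (place-lower cs e)) (shift e (y ∷ []) _)
  place-lower (these a y ∷ cs) e = ↭-trans (prep y (place-lower cs e)) (shift e (y ∷ []) _)
  place-lower (this a    ∷ cs) e with a ≺? e
  ... | yes _ = place-lower cs e
  ... | no  _ = refl

  places-Ordered : ∀ cs es → AllPairs Ordered cs → AllPairs _≺_ es →
                   All (λ e → All (_≺ e) (lower cs)) es → AllPairs Ordered (foldl place cs es)
  places-Ordered cs []       o p        l        = o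
  places-Ordered cs (e ∷ es) o (q ∷ p) (k ∷ l) =
    places-Ordered (place cs e) es (place-Ordered e cs o k) p
      (All.zipWith (λ (e≺e′ , m) → All-resp-↭ (↭-sym (place-lower cs e)) (e≺e′ ∷ m)) (q , l))

  places-upper : ∀ cs es → upper (foldl place cs es) ≡ upper cs
  places-upper cs []       = refl
  places-upper cs (e ∷ es) = trans (places-upper (place cs e) es) (place-upper cs e)

  places-lower : ∀ cs es → lower (foldl place cs es) ↭ es ++ lower cs
  places-lower cs []       = refl
  places-lower cs (e ∷ es) = begin
    lower (foldl place (place cs e) es)  ↭⟨ places-lower (place cs e) es ⟩
    es ++ lower (place cs e)             ↭⟨ ++⁺ˡ es (place-lower cs e) ⟩
    es ++ e ∷ lower cs                   ↭⟨ shift e es _ ⟩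
    e ∷ es ++ lower cs                   ∎
    where open PermutationReasoning

  upper-this : ∀ as → upper (map this as) ≡ as
  upper-this []       = refl
  upper-this (a ∷ as) = cong (a ∷_) (upper-this as)

  lower-this : ∀ as → lower (map this as) ≡ []
  lower-this []       = refl
  lower-this (a ∷ as) = lower-this as

  inflate-Ordered : ∀ above row → Linked _≺_ above → Linked _≺_ row → AllPairs Ordered (inflate above row)
  inflate-Ordered above row p q = places-Ordered (map this above) row
    (AllPairs.map⁺ (Linked⇒AllPairs ≺-trans p)) (Linked⇒AllPairs ≺-trans q)
    (All.universal (λ e → subst (All (_≺ e)) (sym (lower-this above)) []) row)

  inflate-↭ : ∀ above row → lower (inflate above row) ++ upper (inflate above row) ↭ row ++ above
  inflate-↭ above row = ++⁺
    (↭-trans (places-lower (map this above) row)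
      (↭-trans (++⁺ˡ row (↭-reflexive (lower-this above))) (++-comm row [])))
    (↭-reflexive (trans (places-upper (map this above) row) (upper-this above)))

  moveDown-↭ : ∀ x cs → lower (map (moveDown x) cs) ++ upper (map (moveDown x) cs) ↭ lower cs ++ upper cs
  moveDown-↭ x []               = refl
  moveDown-↭ x (that y    ∷ cs) = prep y (moveDown-↭ x cs)
  moveDown-↭ x (these a y ∷ cs) = prep y
    (↭-trans (shift a (lower (map (moveDown x) cs)) _)
      (↭-trans (prep a (moveDown-↭ x cs)) (↭-sym (shift a (lower cs) _))))
  moveDown-↭ x (this a    ∷ cs) with a ≟ᶜ x
  ... | yes _ = ↭-trans (prep a (moveDown-↭ x cs)) (↭-sym (shift a (lower cs) _))
  ... | no  _ = ↭-trans (shift a (lower (map (moveDown x) cs)) _)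
      (↭-trans (prep a (moveDown-↭ x cs)) (↭-sym (shift a (lower cs) _)))

  _≺ᴹ_ : Rel (Maybe ColoredLetter) _
  m ≺ᴹ m′ = MaybeAll.All (λ a → MaybeAll.All (a ≺_) m′) m

  mapMaybe-increasing : ∀ {A : Set} {f : A → Maybe ColoredLetter} {xs} →
                        AllPairs (_≺ᴹ_ on f) xs → AllPairs _≺_ (mapMaybe f xs)
  mapMaybe-increasing []       = []
  mapMaybe-increasing {f = f} {x ∷ xs} (p ∷ ps) with f x
  ... | nothing = mapMaybe-increasing ps
  ... | just a  = All.mapMaybe⁺ (All.map⁺ (All.map (λ { (just q) → q }) p)) ∷ mapMaybe-increasing ps

  moveDown-upper : ∀ x c d → Ordered c d → fromThis (moveDown x c) ≺ᴹ fromThis (moveDown x d)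
  moveDown-upper x (that y)    _           o = nothing
  moveDown-upper x (these a y) (that z)    o = just nothing
  moveDown-upper x (these a y) (these b z) (o , _) = just (just o)
  moveDown-upper x (these a y) (this b)    (o , _) with b ≟ᶜ x
  ... | yes _ = just nothing
  ... | no  _ = just (just o)
  moveDown-upper x (this a) d o with a ≟ᶜ x
  moveDown-upper x (this a) d o           | yes _ = nothing
  moveDown-upper x (this a) (that z) o    | no _  = just nothing
  moveDown-upper x (this a) (these b z) o | no _  = just (just (proj₁ o))
  moveDown-upper x (this a) (this b) o    | no _ with b ≟ᶜ x
  ... | yes _ = just nothing
  ... | no  _ = just (just o)

  moveDown-lower : ∀ x c d → Ordered c d → fromThat (moveDown x c) ≺ᴹ fromThat (moveDown x d)
  moveDown-lower x (that y)    (that z)    o = just (just o)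
  moveDown-lower x (that y)    (these b z) o = just (just (proj₂ o))
  moveDown-lower x (that y)    (this b)    o with b ≟ᶜ x
  ... | yes _ = just (just o)
  ... | no  _ = just nothing
  moveDown-lower x (these a y) (that z)    o = just (just o)
  moveDown-lower x (these a y) (these b z) o = just (just (proj₂ (proj₂ o)))
  moveDown-lower x (these a y) (this b)    o with b ≟ᶜ x
  ... | yes _ = just (just (proj₂ o))
  ... | no  _ = just nothing
  moveDown-lower x (this a) d o with a ≟ᶜ x
  moveDown-lower x (this a) d o           | no _  = nothing
  moveDown-lower x (this a) (that z) o    | yes _ = just (just o)
  moveDown-lower x (this a) (these b z) o | yes _ = just (just (proj₂ o))
  moveDown-lower x (this a) (this b) o    | yes _ with b ≟ᶜ x
  ... | yes _ = just (just o)
  ... | no  _ = just nothing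

  entries-≔ : ∀ (i : Fin (pred n)) (R : Filling n) r s →
              r ++ s ↭ lookup R (low i) ++ lookup R (high i) →
              entries (R [ low i ]≔ r [ high i ]≔ s) ↭ entries R
  entries-≔ {suc (suc n)} zero (a ∷ b ∷ R) r s p = begin
    r ++ (s ++ entries R)  ≡⟨ List.++-assoc r s _ ⟨
    (r ++ s) ++ entries R  ↭⟨ ++⁺ʳ (entries R) p ⟩
    (a ++ b) ++ entries R  ≡⟨ List.++-assoc a b _ ⟩
    a ++ (b ++ entries R)  ∎
    where
    open PermutationReasoning
    import Data.List.Properties as List
  entries-≔ {suc (suc n)} (suc i) (a ∷ R) r s p = ++⁺ˡ a (entries-≔ i R r s p)

  lookup-≔ : ∀ {P : List ColoredLetter → Set} (R : Filling n) j k r s →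
             (∀ l → P (lookup R l)) → P r → P s → ∀ l → P (lookup (R [ j ]≔ r [ k ]≔ s) l)
  lookup-≔ {P = P} R j k r s PR Pr Ps l with l Fin.≟ k
  ... | yes refl = subst P (sym (lookup∘updateAt k (R [ j ]≔ r))) Ps
  ... | no  l≢k with l Fin.≟ j
  ...   | yes refl = subst P (sym (trans (lookup∘updateAt′ l k l≢k (R [ j ]≔ r)) (lookup∘updateAt j R))) Pr
  ...   | no  l≢j  = subst P (sym (trans (lookup∘updateAt′ l k l≢k (R [ j ]≔ r)) (lookup∘updateAt′ l j l≢j R))) (PR l)

open e†-WellDefined

moveDown-isTabloid : {γ : Composition n} (i : Fin (pred n)) (x : ColoredLetter) (T : CT γ) →
                     IsTabloid γ (moveDown-rows i x T)
moveDown-isTabloid i x T = record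
  { increasing = lookup-≔ {P = Linked _≺_} (rows T) (low i) (high i) _ _ (CT.increasing T)
      (increasing fromThat (moveDown-lower x)) (increasing fromThis (moveDown-upper x))
  ; content = ↭-trans
      (entries-≔ i (rows T) _ _ (↭-trans (moveDown-↭ x (inflation i T))
        (inflate-↭ (lookup (rows T) (high i)) (lookup (rows T) (low i)))))
      (CT.content T)
  }
  where
  increasing : (f : These ColoredLetter ColoredLetter → Maybe ColoredLetter) →
               (∀ c d → Ordered c d → f (moveDown x c) ≺ᴹ f (moveDown x d)) →
               Linked _≺_ (mapMaybe f (map (moveDown x) (inflation i T)))
  increasing f h = AllPairs⇒Linked (mapMaybe-increasing {f = f} (AllPairs.map⁺
    (AllPairs.map (λ {c} {d} → h c d)
      (inflate-Ordered _ _ (CT.increasing T (high i)) (CT.increasing T (low i))))))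

e† : {γ : Composition n} → Fin (pred n) → CT γ → Maybe (CT γ)
e† i T = Maybe.map (λ x → mkCT (moveDown-rows i x T) (moveDown-isTabloid i x T))
                   (largest (mapMaybe overEmpty (inflation i T)))

HighestWeight : {γ : Composition n} → CT γ → Set
HighestWeight {n} T = (i : Fin (pred n)) → e† i T ≡ nothing

{-# OPTIONS --safe #-}
module Submission where

-- Reading order lists the cells of γ decreasingly in prismatic order, so the
-- word b records the row of each colored letter and 𝔠 γ is a relabelling.  To
-- compare the operators, bracket b from right to left, remembering only the
-- number of pending closing brackets.  This is an inflation in which the entries
-- of rows i and i + 1 arrive together in increasing order: a new i goes to the
-- right end, and a new i + 1 goes above the leftmost i with no entry above it, or
-- to the right end over an empty cell if there is none.  An i may be paired
-- differently from the usual matching, but the unmatched i + 1 are the same, the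
-- leftmost one being the largest entry above an empty cell.  Finally, an
-- inflation of row i has no empty cell exactly when row i + 1 lies, column by
-- column, above smaller entries of row i.

open import Defs
open import Data.Empty using (⊥-elim)
open import Data.Fin.Base as Fin using (Fin; zero; suc; toℕ)
open import Data.Fin.Properties as Fin using ()
open import Data.List.Base as List
  using (List; []; _∷_; _∷ʳ_; _++_; length; map; foldl; filter; zip; mapMaybe; allFin; reverse; replicate; drop)
open import Data.List.Properties as List
  using (unfold-reverse; map-tabulate; filter-accept; filter-reject; mapMaybe-++; foldl-∷ʳ; ++-assoc;
         ++-identityʳ; reverse-involutive; drop-[])
open import Data.List.Membership.Propositional using (_∈_)
open import Data.List.Membership.Propositional.Properties
  using (∈-map⁺; ∈-map⁻; ∈-filter⁺; ∈-filter⁻; ∈-allFin; ∈-++⁺ˡ; ∈-++⁺ʳ; ∈-++⁻)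
open import Data.List.Relation.Binary.Permutation.Propositional
  using (_↭_; ↭-sym; ↭-trans; ↭⇒↭ₛ)
open import Data.List.Relation.Binary.Permutation.Propositional.Properties
  using (All-resp-↭; ∈-resp-↭; ↭-length; ↭-reverse)
import Data.List.Extrema as Extrema
import Data.List.Relation.Binary.Permutation.Setoid.Properties as Permutationₛ
open import Data.List.Relation.Binary.Prefix.Heterogeneous as Prefix using (Prefix; []; _∷_)
import Data.List.Relation.Binary.Prefix.Heterogeneous.Properties as Prefix
open import Data.List.Relation.Binary.Subset.Propositional using (_⊆_)
open import Data.List.Relation.Unary.All as All using (All; []; _∷_)
import Data.List.Relation.Unary.All.Properties as All
open import Data.List.Relation.Unary.AllPairs as AllPairs using (AllPairs; []; _∷_)
import Data.List.Relation.Unary.AllPairs.Properties as AllPairs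
open import Data.List.Relation.Unary.Any using (here; there)
open import Data.List.Relation.Unary.Linked.Properties using (Linked⇒AllPairs)
open import Data.List.Relation.Unary.Unique.Propositional using (Unique)
open import Data.List.Relation.Unary.Unique.Propositional.Properties using (allFin⁺)
open import Data.Maybe.Base as Maybe using (Maybe; just; nothing)
open import Data.Maybe.Relation.Binary.Pointwise using (Pointwise; just; nothing)
open import Data.Nat.Base as ℕ using (ℕ; zero; suc; pred; s≤s; z≤n)
open import Data.Nat.Properties as ℕ using ()
open import Data.Product.Base using (_×_; _,_; proj₁; proj₂; ∃; ∃₂)
open import Data.Sum.Base using (inj₁; inj₂)
open import Data.These using (These; this; that; these)
open import Data.Vec.Base as Vec using (Vec; []; _∷_; lookup; tabulate; toList; _[_]≔_)
open import Data.Vec.Relation.Unary.Linked using (Linked; _∷_)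
open import Data.Vec.Properties as Vec
  using (lookup∘tabulate; lookup∘update; lookup∘update′; []≔-lookup; toList∘fromList;
         tabulate-cong; tabulate-∘; tabulate∘lookup)
open import Function.Base using (_∘_; flip)
open import Function.Definitions using (Bijective)
open import Level using (0ℓ)
open import Relation.Binary.Core using (Rel)
open import Relation.Binary.Definitions using (tri<; tri≈; tri>)
open import Relation.Binary.PropositionalEquality
  using (_≡_; _≢_; refl; sym; trans; cong; cong₂; subst; subst₂; setoid; module ≡-Reasoning)
open import Relation.Nullary.Decidable.Core using (yes; no)
open import Relation.Nullary.Negation.Core using (¬_; contradiction)
open import Relation.Unary using (_≐_)

open 𝔠-WellDefined
open e†-WellDefined

private
  variable
    n : ℕ
    A B : Set

-- Prismatic order and increasing lists.

≺-irrefl : ∀ {x} → ¬ x ≺ x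
≺-irrefl {x} x≺x with ≺-compare x x
... | tri< _ x≢x _ = x≢x refl
... | tri≈ x⊀x _ _ = x⊀x x≺x
... | tri> _ x≢x _ = x≢x refl

≺-asym : ∀ {x y} → x ≺ y → ¬ y ≺ x
≺-asym x≺y y≺x = ≺-irrefl (≺-trans x≺y y≺x)

≺-connex : ∀ {x y} → ¬ x ≺ y → x ≢ y → y ≺ x
≺-connex {x} {y} x⊀y x≢y with ≺-compare x y
... | tri< x≺y _ _ = contradiction x≺y x⊀y
... | tri≈ _ x≡y _ = contradiction x≡y x≢y
... | tri> _ _ y≺x = y≺x

-- If the heads differed, each would lie in the tail of the other list and so exceed the other. Once
-- they agree, no tail entry equals the common head, and both inclusions pass to the tails.
increasing-ext : ∀ {xs ys} → AllPairs _≺_ xs → AllPairs _≺_ ys → xs ⊆ ys → ys ⊆ xs → xs ≡ ys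
increasing-ext {[]}     {[]}     _ _ _ _ = refl
increasing-ext {[]}     {y ∷ ys} _ _ _ ys⊆ with () ← ys⊆ (here refl)
increasing-ext {x ∷ xs} {[]}     _ _ xs⊆ _ with () ← xs⊆ (here refl)
increasing-ext {x ∷ xs} {y ∷ ys} (x≺xs ∷ p) (y≺ys ∷ q) xs⊆ ys⊆ =
  cong₂ _∷_ x≡y (increasing-ext p q
    (λ z∈ → strip (λ { refl → ≺-irrefl (subst (_≺ _) x≡y (All.lookup x≺xs z∈)) }) (xs⊆ (there z∈)))
    (λ z∈ → strip (λ { refl → ≺-irrefl (subst (_≺ _) (sym x≡y) (All.lookup y≺ys z∈)) }) (ys⊆ (there z∈))))
  where
  strip : ∀ {z w ws} → z ≢ w → z ∈ w ∷ ws → z ∈ ws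
  strip z≢w (here z≡w) = contradiction z≡w z≢w
  strip z≢w (there z∈) = z∈
  x≡y : x ≡ y
  x≡y with xs⊆ (here refl) | ys⊆ (here refl)
  ... | here x≡y | _        = x≡y
  ... | there _  | here y≡x = sym y≡x
  ... | there x∈ | there y∈ = contradiction (All.lookup x≺xs y∈) (≺-asym (All.lookup y≺ys x∈))

-- Reading order and positions of a word.

reverse-AllPairs : ∀ {R : Rel A 0ℓ} {xs} → AllPairs (flip R) xs → AllPairs R (reverse xs)
reverse-AllPairs []                  = []
reverse-AllPairs {R = R} {x ∷ xs} (p ∷ ps) = subst (AllPairs R) (sym (unfold-reverse x xs))
  (AllPairs.++⁺ (reverse-AllPairs ps) ([] ∷ [])
    (All.tabulate λ y∈ → All.lookup p (∈-resp-↭ (↭-reverse xs) y∈) ∷ []))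

-- Higher rows are read first and hold larger letters; within a row the subscripts grow, so the
-- letters shrink.
cellsFrom-decreasing : ∀ r γ → AllPairs (flip _≺_) (cellsFrom r γ)
cellsFrom-decreasing r []      = []
cellsFrom-decreasing r (g ∷ γ) = AllPairs.++⁺ (cellsFrom-decreasing (suc r) γ)
  (AllPairs.map⁺ (AllPairs.applyUpTo⁺₁ _ g λ i<j _ → inj₂ (refl , s≤s i<j)))
  (All.tabulate λ x∈γ → All.tabulate λ y∈g → below (cellsFrom-≥ (suc r) γ x∈γ) y∈g)
  where
  below : ∀ {x y} → suc r ℕ.≤ proj₁ x → y ∈ rowCells r g → y ≺ x
  below r<x y∈g with ∈-map⁻ _ y∈g
  ... | _ , _ , refl = inj₁ r<x

module _ (γ : Composition n) where

  private
    -- A vector of length exactly `n` lets the letters of a word and the cells that they fill share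
    -- the index set `Fin n`.
    cellVec : ∃ λ (v : Vec Cell n) → toList v ≡ cells (Composition.parts γ)
    cellVec = asVec (cells (Composition.parts γ))
      (trans (cellsFrom-length 1 (Composition.parts γ)) (Composition.total γ))
      where
      asVec : ∀ {m} (xs : List Cell) → length xs ≡ m → ∃ λ (v : Vec Cell m) → toList v ≡ xs
      asVec xs refl = Vec.fromList xs , toList∘fromList xs

  cell : Fin n → Cell
  cell = lookup (proj₁ cellVec)

  private
    zip-toList : ∀ {m} (u : Vec A m) (v : Vec B m) →
                 zip (toList u) (toList v) ≡ map (λ k → lookup u k , lookup v k) (allFin m)
    zip-toList u v = trans (go u v) (sym (map-tabulate (λ k → k) _))
      where
      go : ∀ {m} (u : Vec A m) (v : Vec B m) →
           zip (toList u) (toList v) ≡ List.tabulate (λ k → lookup u k , lookup v k)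
      go []      []      = refl
      go (x ∷ u) (y ∷ v) = cong (_ ∷_) (go u v)

  fill-positions : (b : Word n) → fill γ b ≡ map (λ k → cell k , lookup b k) (allFin n)
  fill-positions b = trans (cong (λ xs → zip xs (toList b)) (sym (proj₂ cellVec))) (zip-toList (proj₁ cellVec) b)

  cells-positions : cells (Composition.parts γ) ≡ map cell (allFin n)
  cells-positions = trans (sym (proj₂ cellVec)) (trans (go (proj₁ cellVec)) (sym (map-tabulate (λ k → k) _)))
    where
    go : ∀ {m} (u : Vec A m) → toList u ≡ List.tabulate (lookup u)
    go []      = refl
    go (x ∷ u) = cong (_ ∷_) (go u)

  cell-decreasing : AllPairs (λ k l → cell l ≺ cell k) (allFin n)
  cell-decreasing = AllPairs.map⁻ (subst (AllPairs (flip _≺_)) cells-positions (cellsFrom-decreasing 1 (Composition.parts γ)))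

  cell-injective : ∀ {j k} → cell j ≡ cell k → j ≡ k
  cell-injective {j} {k} eq = go (allFin n) cell-decreasing (∈-allFin j) (∈-allFin k)
    where
    go : ∀ ks → AllPairs (λ k l → cell l ≺ cell k) ks → j ∈ ks → k ∈ ks → j ≡ k
    go _ _        (here refl) (here refl) = refl
    go _ (d ∷ _)  (here refl) (there k∈)  = ⊥-elim (≺-irrefl (subst (_≺ cell j) (sym eq) (All.lookup d k∈)))
    go _ (d ∷ _)  (there j∈)  (here refl) = ⊥-elim (≺-irrefl (subst (_≺ cell k) eq (All.lookup d j∈)))
    go _ (_ ∷ ds) (there j∈)  (there k∈)  = go _ ds j∈ k∈

-- Rows of the tabloid of a word.

positions : Word n → Fin n → List (Fin n) → List (Fin n)
positions b e = filter (λ k → lookup b k Fin.≟ e)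

-- Reading order is decreasing, so a row lists its positions backwards.

rowOf : (Fin n → Cell) → Word n → Fin n → List (Fin n) → List Cell
rowOf c b e ks = reverse (map c (positions b e ks))

rowOf-accept : ∀ (c : Fin n → Cell) b {e k} ks → lookup b k ≡ e →
               rowOf c b e (k ∷ ks) ≡ rowOf c b e ks ∷ʳ c k
rowOf-accept c b {e} {k} ks bk≡e = trans
  (cong (reverse ∘ map c) (filter-accept (λ k → lookup b k Fin.≟ e) bk≡e))
  (unfold-reverse (c k) (map c (positions b e ks)))

rowOf-reject : ∀ (c : Fin n → Cell) b {e k} ks → lookup b k ≢ e → rowOf c b e (k ∷ ks) ≡ rowOf c b e ks
rowOf-reject c b {e} ks bk≢e = cong (reverse ∘ map c) (filter-reject (λ k → lookup b k Fin.≟ e) bk≢e)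

rowOf-⊆ : ∀ (c : Fin n → Cell) b e ks → rowOf c b e ks ⊆ map c ks
rowOf-⊆ c b e ks x∈ with ∈-map⁻ c (∈-resp-↭ (↭-reverse _) x∈)
... | k , k∈ , refl = ∈-map⁺ c (proj₁ (∈-filter⁻ (λ k → lookup b k Fin.≟ e) k∈))

module _ (γ : Composition n) (b : Word n) where

  cellsWith-positions : ∀ e → cellsWith e (fill γ b) ≡ map (cell γ) (positions b e (allFin n))
  cellsWith-positions e = trans (cong (cellsWith e) (fill-positions γ b)) (go (allFin n))
    where
    go : ∀ ks → cellsWith e (map (λ k → cell γ k , lookup b k) ks) ≡ map (cell γ) (positions b e ks)
    go []       = refl
    go (k ∷ ks) with lookup b k Fin.≟ e
    ... | yes _ = cong (_ ∷_) (go ks)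
    ... | no  _ = go ks

  -- Sorting, and reversing the decreasing reading order, give increasing lists with the same
  -- members. In the reversed form, a position added on the left of a suffix of the word appends its
  -- cell at the right end of a row.
  row-𝔠 : ∀ e → lookup (rows (𝔠 γ b)) e ≡ rowOf (cell γ) b e (allFin n)
  row-𝔠 e = trans (lookup∘tabulate _ e) (increasing-ext
    (Linked⇒AllPairs ≺-trans (sort-increasing (cellsWith-unique e (fill γ b) (fill-unique γ b))))
    (reverse-AllPairs (AllPairs.map⁺ (AllPairs.filter⁺ _ (cell-decreasing γ))))
    (∈-resp-↭ sort↭reverse) (∈-resp-↭ (↭-sym sort↭reverse)))
    where
    sort↭reverse : sort (cellsWith e (fill γ b)) ↭ rowOf (cell γ) b e (allFin n)
    sort↭reverse = ↭-trans (sort-↭ _)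
      (subst (_↭ rowOf (cell γ) b e (allFin n)) (sym (cellsWith-positions e)) (↭-sym (↭-reverse _)))

  ∈-𝔠⁺ : ∀ k → cell γ k ∈ lookup (rows (𝔠 γ b)) (lookup b k)
  ∈-𝔠⁺ k = subst (cell γ k ∈_) (sym (row-𝔠 (lookup b k)))
    (∈-resp-↭ (↭-sym (↭-reverse _)) (∈-map⁺ (cell γ) (∈-filter⁺ _ (∈-allFin k) refl)))

  ∈-𝔠⁻ : ∀ {e x} → x ∈ lookup (rows (𝔠 γ b)) e → ∃ λ k → x ≡ cell γ k × lookup b k ≡ e
  ∈-𝔠⁻ {e} x∈ with ∈-map⁻ (cell γ) (∈-resp-↭ (↭-reverse _) (subst (_ ∈_) (row-𝔠 e) x∈))
  ... | k , k∈ , x≡ = k , x≡ , proj₂ (∈-filter⁻ (λ k → lookup b k Fin.≟ e) {xs = allFin n} k∈)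

-- Tabloids as placements of distinct letters; bijectivity and weight.

∈-entries⁺ : ∀ (R : Vec (List Cell) n) e {x} → x ∈ lookup R e → x ∈ List.concat (toList R)
∈-entries⁺ (r ∷ R) zero    x∈ = ∈-++⁺ˡ x∈
∈-entries⁺ (r ∷ R) (suc e) x∈ = ∈-++⁺ʳ r (∈-entries⁺ R e x∈)

∈-entries⁻ : ∀ (R : Vec (List Cell) n) {x} → x ∈ List.concat (toList R) → ∃ λ e → x ∈ lookup R e
∈-entries⁻ (r ∷ R) x∈ with ∈-++⁻ r x∈
... | inj₁ x∈r = zero , x∈r
... | inj₂ x∈R with ∈-entries⁻ R x∈R
...   | e , x∈e = suc e , x∈e

Unique-++-disjoint : ∀ (xs : List A) {ys x} → Unique (xs ++ ys) → x ∈ xs → ¬ x ∈ ys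
Unique-++-disjoint (x ∷ xs) (x∉ ∷ u) (here refl) x∈ys = All.lookup x∉ (∈-++⁺ʳ xs x∈ys) refl
Unique-++-disjoint (x ∷ xs) (x∉ ∷ u) (there x∈)  x∈ys = Unique-++-disjoint xs u x∈ x∈ys

Unique-++⁻ʳ : ∀ (xs : List A) {ys} → Unique (xs ++ ys) → Unique ys
Unique-++⁻ʳ []       u       = u
Unique-++⁻ʳ (x ∷ xs) (_ ∷ u) = Unique-++⁻ʳ xs u

entries-row-unique : ∀ (R : Vec (List Cell) n) → Unique (List.concat (toList R)) →
                     ∀ {e e′ x} → x ∈ lookup R e → x ∈ lookup R e′ → e ≡ e′
entries-row-unique (r ∷ R) u {zero}  {zero}   _  _   = refl
entries-row-unique (r ∷ R) u {zero}  {suc e′} x∈ x∈′ = ⊥-elim (Unique-++-disjoint r u x∈ (∈-entries⁺ R e′ x∈′))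
entries-row-unique (r ∷ R) u {suc e} {zero}   x∈ x∈′ = ⊥-elim (Unique-++-disjoint r u x∈′ (∈-entries⁺ R e x∈))
entries-row-unique (r ∷ R) u {suc e} {suc e′} x∈ x∈′ = cong suc (entries-row-unique R (Unique-++⁻ʳ r u) x∈ x∈′)

module _ {γ : Composition n} where

  row-unique : (T : CT γ) → ∀ {e e′ x} → x ∈ lookup (rows T) e → x ∈ lookup (rows T) e′ → e ≡ e′
  row-unique T = entries-row-unique (rows T)
    (Permutationₛ.Unique-resp-↭ (setoid _) (↭⇒↭ₛ (↭-sym (CT.content T))) (cellsFrom-unique 1 (Composition.parts γ)))

  -- One inclusion suffices because T and T′ have the same entries.
  rows-⊆⇒≈ : (T T′ : CT γ) → (∀ e → lookup (rows T) e ⊆ lookup (rows T′) e) → T ≈ T′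
  rows-⊆⇒≈ T T′ T⊆T′ = begin
    rows T                       ≡⟨ tabulate∘lookup (rows T) ⟨
    tabulate (lookup (rows T))   ≡⟨ tabulate-cong row≡ ⟩
    tabulate (lookup (rows T′))  ≡⟨ tabulate∘lookup (rows T′) ⟩
    rows T′                      ∎
    where
    open ≡-Reasoning
    T′⊆T : ∀ e → lookup (rows T′) e ⊆ lookup (rows T) e
    T′⊆T e x∈T′ with ∈-entries⁻ (rows T)
      (∈-resp-↭ (↭-trans (CT.content T′) (↭-sym (CT.content T))) (∈-entries⁺ (rows T′) e x∈T′))
    ... | e′ , x∈T with refl ← row-unique T′ (T⊆T′ e′ x∈T) x∈T′ = x∈T
    row≡ : ∀ e → lookup (rows T) e ≡ lookup (rows T′) e
    row≡ e = increasing-ext (Linked⇒AllPairs ≺-trans (CT.increasing T e))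
      (Linked⇒AllPairs ≺-trans (CT.increasing T′ e)) (T⊆T′ e) (T′⊆T e)

vec-ext : ∀ {u v : Vec A n} → (∀ k → lookup u k ≡ lookup v k) → u ≡ v
vec-ext {u = u} {v} u≗v = trans (sym (tabulate∘lookup u)) (trans (tabulate-cong u≗v) (tabulate∘lookup v))

-- The row containing the letter `cell γ k` is `lookup b k`, so the tabloid determines the word.
-- Conversely, the row indices of the letters of `T`, taken in reading order, form a preimage of
-- `T`.
𝔠-bijective : (γ : Composition n) → Bijective _≡_ _≈_ (𝔠 γ)
𝔠-bijective {n} γ = injective , surjective
  where
  injective : ∀ {b b′} → 𝔠 γ b ≈ 𝔠 γ b′ → b ≡ b′
  injective {b} {b′} 𝔠b≈𝔠b′ = vec-ext λ k → row-unique (𝔠 γ b′)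
    (subst (λ R → cell γ k ∈ lookup R (lookup b k)) 𝔠b≈𝔠b′ (∈-𝔠⁺ γ b k)) (∈-𝔠⁺ γ b′ k)

  surjective : ∀ T → ∃ λ b → ∀ {b′} → b′ ≡ b → 𝔠 γ b′ ≈ T
  surjective T = b , λ { refl → rows-⊆⇒≈ (𝔠 γ b) T 𝔠b⊆T }
    where
    rowIndex : ∀ k → ∃ λ e → cell γ k ∈ lookup (rows T) e
    rowIndex k = ∈-entries⁻ (rows T) (∈-resp-↭ (↭-sym (CT.content T))
      (subst (cell γ k ∈_) (sym (cells-positions γ)) (∈-map⁺ (cell γ) (∈-allFin k))))
    b : Word n
    b = tabulate (proj₁ ∘ rowIndex)
    𝔠b⊆T : ∀ e → lookup (rows (𝔠 γ b)) e ⊆ lookup (rows T) e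
    𝔠b⊆T e x∈ with ∈-𝔠⁻ γ b x∈
    ... | k , refl , refl = subst (λ e → cell γ k ∈ lookup (rows T) e)
      (sym (lookup∘tabulate (proj₁ ∘ rowIndex) k)) (proj₂ (rowIndex k))

𝔠-wt : (γ : Composition n) (b : Word n) → wt (𝔠 γ b) ≡ wtʷ b
𝔠-wt γ b = trans (sym (tabulate-∘ length _)) (tabulate-cong λ e → trans (↭-length (sort-↭ (cellsWith e (fill γ b))))
  (count-zip e (cells (Composition.parts γ)) b
    (trans (cellsFrom-length 1 (Composition.parts γ)) (Composition.total γ))))
  where
  count-zip : ∀ {m} e (xs : List Cell) (v : Vec (Fin n) m) → length xs ≡ m →
              length (cellsWith e (zip xs (toList v))) ≡ Vec.count (Fin._≟ e) v
  count-zip e []       []      _  = refl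
  count-zip e (x ∷ xs) (y ∷ v) eq with y Fin.≟ e
  ... | yes _ = cong suc (count-zip e xs v (ℕ.suc-injective eq))
  ... | no  _ = count-zip e xs v (ℕ.suc-injective eq)

-- Parenthesis matching and the operator on words.

low≢high : (i : Fin (pred n)) → low {n} i ≢ high i
low≢high {suc (suc n)} (suc i) eq = low≢high {suc n} i (Fin.suc-injective eq)

-- Unmatched i b ks p us: bracketing the letters at the positions ks from right
-- to left leaves p unmatched closing brackets, and the unmatched opening ones
-- are at the positions us.

module _ (i : Fin (pred n)) (b : Word n) where

  data Unmatched : List (Fin n) → ℕ → List (Fin n) → Set where
    []        : Unmatched [] 0 []
    other     : ∀ {k ks p us} → lookup b k ≢ high i → lookup b k ≢ low i →
                Unmatched ks p us → Unmatched (k ∷ ks) p us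
    close     : ∀ {k ks p us} → lookup b k ≡ low i →
                Unmatched ks p us → Unmatched (k ∷ ks) (suc p) us
    open-free : ∀ {k ks us} → lookup b k ≡ high i →
                Unmatched ks 0 us → Unmatched (k ∷ ks) 0 (k ∷ us)
    open-pair : ∀ {k ks p us} → lookup b k ≡ high i →
                Unmatched ks (suc p) us → Unmatched (k ∷ ks) p us

  unmatched-total : ∀ ks → ∃₂ (Unmatched ks)
  unmatched-total []       = 0 , [] , []
  unmatched-total (k ∷ ks) with unmatched-total ks | lookup b k Fin.≟ high i | lookup b k Fin.≟ low i
  ... | zero  , us , u | yes hi | _      = 0 , k ∷ us , open-free hi u
  ... | suc p , us , u | yes hi | _      = p , us , open-pair hi u
  ... | p     , us , u | no _   | yes lo = suc p , us , close lo u
  ... | p     , us , u | no ¬hi | no ¬lo = p , us , other ¬hi ¬lo u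

  unmatched-high : ∀ {ks p us} → Unmatched ks p us → All (λ k → lookup b k ≡ high i) us
  unmatched-high []                = []
  unmatched-high (other _ _ u)     = unmatched-high u
  unmatched-high (close _ u)       = unmatched-high u
  unmatched-high (open-free hi u)  = hi ∷ unmatched-high u
  unmatched-high (open-pair _ u)   = unmatched-high u

  unmatched-All : ∀ {P : Fin n → Set} {ks p us} → Unmatched ks p us → All P ks → All P us
  unmatched-All []              []         = []
  unmatched-All (other _ _ u)   (_ ∷ pks)  = unmatched-All u pks
  unmatched-All (close _ u)     (_ ∷ pks)  = unmatched-All u pks
  unmatched-All (open-free _ u) (pk ∷ pks) = pk ∷ unmatched-All u pks
  unmatched-All (open-pair _ u) (_ ∷ pks)  = unmatched-All u pks

  unmatched-AllPairs : ∀ {R : Rel (Fin n) 0ℓ} {ks p us} → Unmatched ks p us → AllPairs R ks → AllPairs R us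
  unmatched-AllPairs []              []       = []
  unmatched-AllPairs (other _ _ u)   (_ ∷ rs) = unmatched-AllPairs u rs
  unmatched-AllPairs (close _ u)     (_ ∷ rs) = unmatched-AllPairs u rs
  unmatched-AllPairs (open-free _ u) (r ∷ rs) = unmatched-All u r ∷ unmatched-AllPairs u rs
  unmatched-AllPairs (open-pair _ u) (_ ∷ rs) = unmatched-AllPairs u rs

  scan-high : ∀ {k} closes opens → lookup b k ≡ high i → scan i b (closes , opens) k ≡ (closes , k ∷ opens)
  scan-high {k} _ _ hi with lookup b k Fin.≟ high i
  ... | yes _  = refl
  ... | no ¬hi = contradiction hi ¬hi

  scan-other : ∀ {k} closes opens → lookup b k ≢ high i → lookup b k ≢ low i →
               scan i b (closes , opens) k ≡ (closes , opens)
  scan-other {k} _ _ ¬hi ¬lo with lookup b k Fin.≟ high i | lookup b k Fin.≟ low i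
  ... | yes hi | _      = contradiction hi ¬hi
  ... | no _   | yes lo = contradiction lo ¬lo
  ... | no _   | no _   = refl

  -- `drop 1` covers both branches: it pops the innermost pending opening bracket, or leaves the
  -- empty list when the closing bracket is unmatched. The new list of closing positions stays
  -- existential, since the opening ones do not depend on it.
  scan-low : ∀ {k} closes opens → lookup b k ≡ low i →
             ∃ λ closes′ → scan i b (closes , opens) k ≡ (closes′ , drop 1 opens)
  scan-low {k} _ opens lo with lookup b k Fin.≟ high i | lookup b k Fin.≟ low i
  ... | yes hi | _      = contradiction (trans (sym lo) hi) (low≢high {n} i)
  ... | no _   | no ¬lo = contradiction lo ¬lo
  scan-low _ []      lo | no _ | yes _ = _ , refl
  scan-low _ (_ ∷ _) lo | no _ | yes _ = _ , refl

  -- The left-to-right scan is started in an arbitrary state so that it can be compared with the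
  -- right-to-left recursion. The `p` closing brackets left over from `ks` use up the `p` most
  -- recent openings of that state, while the openings `us` within `ks` survive on top of it. In the
  -- case `open-pair`, the bracket just pushed is the first one dropped.
  scan-opens : ∀ {ks p us} → Unmatched ks p us → ∀ closes opens →
               proj₂ (foldl (scan i b) (closes , opens) ks) ≡ reverse us ++ drop p opens
  scan-opens [] _ _ = refl
  scan-opens (other {k} {ks} ¬hi ¬lo u) cl op =
    trans (cong (λ st → proj₂ (foldl (scan i b) st ks)) (scan-other cl op ¬hi ¬lo)) (scan-opens u cl op)
  scan-opens (close {k} {ks} {p} {us} lo u) cl op with scan-low cl op lo
  ... | cl′ , eq = trans (cong (λ st → proj₂ (foldl (scan i b) st ks)) eq) (trans (scan-opens u cl′ (drop 1 op))
    (cong (reverse us ++_) (List.drop-drop 1 p op)))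
  scan-opens (open-free {k} {ks} {us} hi u) cl op =
    trans (cong (λ st → proj₂ (foldl (scan i b) st ks)) (scan-high cl op hi)) (trans (scan-opens u cl (k ∷ op))
      (trans (sym (++-assoc (reverse us) (k ∷ []) op)) (cong (_++ op) (sym (unfold-reverse k us)))))
  scan-opens (open-pair {k} {ks} hi u) cl op =
    trans (cong (λ st → proj₂ (foldl (scan i b) st ks)) (scan-high cl op hi)) (scan-opens u cl (k ∷ op))

  scan-closes : ∀ ks {closes opens} → All (λ k → lookup b k ≡ low i) closes →
                All (λ k → lookup b k ≡ low i) (proj₁ (foldl (scan i b) (closes , opens) ks))
  scan-closes []       cl = cl
  scan-closes (k ∷ ks) {closes} {opens} cl = scan-closes ks (step opens)
    where
    step : ∀ opens → All (λ k → lookup b k ≡ low i) (proj₁ (scan i b (closes , opens) k))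
    step opens with lookup b k Fin.≟ high i | lookup b k Fin.≟ low i
    ... | yes _ | _      = cl
    ... | no _  | no _   = cl
    step []      | no _ | yes lo = lo ∷ cl
    step (_ ∷ _) | no _ | yes _  = cl

  -- Which closing brackets stay unmatched is immaterial for `ẽ`: they already carry `low i`, so
  -- rewriting them as `low i` changes nothing.
  unmatched-closes : All (λ k → lookup b k ≡ low i) (proj₁ (unmatched i b))
  unmatched-closes = All-resp-↭ (↭-sym (↭-reverse _)) (scan-closes (allFin n) [])

  unmatched-opens : ∀ {p us} → Unmatched (allFin n) p us → proj₂ (unmatched i b) ≡ us
  unmatched-opens {p} {us} u = begin
    reverse (proj₂ (foldl (scan i b) ([] , []) (allFin n)))  ≡⟨ cong reverse (scan-opens u [] []) ⟩
    reverse (reverse us ++ drop p [])                        ≡⟨ cong (λ xs → reverse (reverse us ++ xs)) (drop-[] p) ⟩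
    reverse (reverse us ++ [])                               ≡⟨ cong reverse (++-identityʳ (reverse us)) ⟩
    reverse (reverse us)                                     ≡⟨ reverse-involutive us ⟩
    us                                                       ∎
    where open ≡-Reasoning

overwrite-id : ∀ (b : Word n) e ks m → All (λ k → lookup b k ≡ e) ks → overwrite (zip ks (replicate m e)) b ≡ b
overwrite-id b e []       m       []         = refl
overwrite-id b e (k ∷ ks) zero    _          = refl
overwrite-id b e (k ∷ ks) (suc m) (bk ∷ bks) = trans
  (cong (overwrite (zip ks (replicate m e))) (trans (cong (b [ k ]≔_) (sym bk)) ([]≔-lookup b k)))
  (overwrite-id b e ks m bks)

overwrite-++ : ∀ (b : Word n) e ks kxs xs → All (λ k → lookup b k ≡ e) ks →
               overwrite (zip (ks ++ kxs) (replicate (length ks) e ++ xs)) b ≡ overwrite (zip kxs xs) b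
overwrite-++ b e []       kxs xs []         = refl
overwrite-++ b e (k ∷ ks) kxs xs (bk ∷ bks) = trans
  (cong (overwrite (zip (ks ++ kxs) (replicate (length ks) e ++ xs)))
    (trans (cong (b [ k ]≔_) (sym bk)) ([]≔-lookup b k)))
  (overwrite-++ b e ks kxs xs bks)

replicate-suc-++ : ∀ m (x : A) ys → replicate (suc m) x ++ ys ≡ replicate m x ++ x ∷ ys
replicate-suc-++ zero    x ys = refl
replicate-suc-++ (suc m) x ys = cong (x ∷_) (replicate-suc-++ m x ys)

ẽ-nothing : ∀ (i : Fin (pred n)) (b : Word n) → proj₂ (unmatched i b) ≡ [] → ẽ i b ≡ nothing
ẽ-nothing i b eq with proj₂ (unmatched i b)
ẽ-nothing i b refl | .[] = refl

-- The old and new unmatched subwords differ in one letter only, at the leftmost unmatched opening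
-- bracket `k`. Since `k` is not in `ks`, the positions in `ks` still carry `high i` after the
-- change at `k`, and rewriting them has no effect.
ẽ-just : ∀ (i : Fin (pred n)) (b : Word n) {k ks} → proj₂ (unmatched i b) ≡ k ∷ ks →
         All (k ≢_) ks → All (λ k → lookup b k ≡ high i) ks → ẽ i b ≡ just (b [ k ]≔ low i)
ẽ-just i b {k} {ks} eq k∉ks hi with proj₁ (unmatched i b) | unmatched-closes i b | proj₂ (unmatched i b)
ẽ-just i b {k} {ks} refl k∉ks hi | closes | lo | .(k ∷ ks) = cong just (begin
  overwrite (zip (closes ++ k ∷ ks) (replicate (suc (length closes)) (low i) ++ highs)) b
    -- Moving one `low i` behind the block aligns the block with `closes` and that `low i` with `k`.
    ≡⟨ cong (λ xs → overwrite (zip (closes ++ k ∷ ks) xs) b) (replicate-suc-++ (length closes) (low i) highs) ⟩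
  overwrite (zip (closes ++ k ∷ ks) (replicate (length closes) (low i) ++ low i ∷ highs)) b
    ≡⟨ overwrite-++ b (low i) closes (k ∷ ks) (low i ∷ highs) lo ⟩
  overwrite (zip ks highs) (b [ k ]≔ low i)
    ≡⟨ overwrite-id (b [ k ]≔ low i) (high i) ks (length ks) (All.zipWith still (k∉ks , hi)) ⟩
  b [ k ]≔ low i
    ∎)
  where
  open ≡-Reasoning
  highs = replicate (length ks) (high i)
  still : ∀ {j} → k ≢ j × lookup b j ≡ high i → lookup (b [ k ]≔ low i) j ≡ high i
  still (k≢j , hi) = trans (lookup∘update′ (k≢j ∘ sym) b (low i)) hi

-- Inflations of growing rows.

underEmpty : These Cell Cell → Maybe Cell
underEmpty (that y)    = just y
underEmpty (this a)    = nothing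
underEmpty (these a y) = nothing

-- The effect on an inflation of a new largest entry of the upper row.

attach : Cell → Columns → Columns
attach a []               = this a ∷ []
attach a (that y ∷ cs)    = these a y ∷ cs
attach a (this b ∷ cs)    = this b ∷ attach a cs
attach a (these b y ∷ cs) = these b y ∷ attach a cs

-- An upper entry not smaller than `e` does not block its cell, so `e` ends in the same column
-- whether `a` arrives before or after it.
place-attach : ∀ {a e} → ¬ a ≺ e → ∀ cs → place (attach a cs) e ≡ attach a (place cs e)
place-attach {a} {e} a⊀e [] with a ≺? e
... | yes a≺e = contradiction a≺e a⊀e
... | no  _   = refl
place-attach a⊀e (that y ∷ cs)    = refl
place-attach {e = e} a⊀e (this b ∷ cs) with b ≺? e
... | yes _ = cong (this b ∷_) (place-attach a⊀e cs)
... | no  _ = refl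
place-attach a⊀e (these b y ∷ cs) = cong (these b y ∷_) (place-attach a⊀e cs)

places-attach : ∀ {a} es → All (λ e → ¬ a ≺ e) es → ∀ cs →
                foldl place (attach a cs) es ≡ attach a (foldl place cs es)
places-attach []       []           cs = refl
places-attach (e ∷ es) (a⊀e ∷ a⊀es) cs =
  trans (cong (λ ds → foldl place ds es) (place-attach a⊀e cs)) (places-attach es a⊀es (place cs e))

-- Before any placement, `attach` merely appends a column; it then commutes past every placement.
inflate-upper-∷ʳ : ∀ {a} as es → All (_≺ a) es → inflate (as ∷ʳ a) es ≡ attach a (inflate as es)
inflate-upper-∷ʳ {a} as es es≺a = trans (cong (λ cs → foldl place cs es) (this-∷ʳ as))
  (places-attach es (All.map ≺-asym es≺a) (map this as))
  where
  this-∷ʳ : ∀ as → map this (as ∷ʳ a) ≡ attach a (map this as)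
  this-∷ʳ []       = refl
  this-∷ʳ (b ∷ as) = cong (this b ∷_) (this-∷ʳ as)

-- Every upper entry blocks `e`, so only a new column at the right end is left.
place-last : ∀ {e} cs → All (_≺ e) (upper cs) → place cs e ≡ cs ∷ʳ that e
place-last []               _            = refl
place-last (that y ∷ cs)    p            = cong (that y ∷_) (place-last cs p)
place-last (these a y ∷ cs) (_ ∷ p)      = cong (these a y ∷_) (place-last cs p)
place-last {e} (this a ∷ cs) (a≺e ∷ p) with a ≺? e
... | yes _   = cong (this a ∷_) (place-last cs p)
... | no  a⊀e = contradiction a≺e a⊀e

inflate-lower-∷ʳ : ∀ {e} as es → All (_≺ e) as → inflate as (es ∷ʳ e) ≡ inflate as es ∷ʳ that e
inflate-lower-∷ʳ {e} as es as≺e = trans (foldl-∷ʳ place (map this as) e es)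
  (place-last (inflate as es)
    (subst (All (_≺ e)) (sym (trans (places-upper (map this as) es) (upper-this as))) as≺e))

overEmpties : Columns → List Cell
overEmpties = mapMaybe overEmpty

-- In the bracket picture these are the pending closing brackets, while `overEmpties` gives the
-- unmatched opening ones.
underEmpties : Columns → List Cell
underEmpties = mapMaybe underEmpty

attach-free : ∀ a cs → length (underEmpties cs) ≡ 0 →
              overEmpties (attach a cs) ≡ overEmpties cs ∷ʳ a × length (underEmpties (attach a cs)) ≡ 0
attach-free a []               eq = refl , refl
attach-free a (this b ∷ cs)    eq with attach-free a cs eq
... | p , q = cong (b ∷_) p , q
attach-free a (these b y ∷ cs) eq = attach-free a cs eq

attach-pair : ∀ a {p} cs → length (underEmpties cs) ≡ suc p →
              overEmpties (attach a cs) ≡ overEmpties cs × length (underEmpties (attach a cs)) ≡ p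
attach-pair a (that y ∷ cs)    eq = refl , ℕ.suc-injective eq
attach-pair a (this b ∷ cs)    eq with attach-pair a cs eq
... | p , q = cong (b ∷_) p , q
attach-pair a (these b y ∷ cs) eq = attach-pair a cs eq

module _ (i : Fin (pred n)) (b : Word n) (c : Fin n → Cell) where

  inflated : List (Fin n) → Columns
  inflated ks = inflate (rowOf c b (high i) ks) (rowOf c b (low i) ks)

  rowOf-All : ∀ {k} e ks → All (λ l → c l ≺ c k) ks → All (_≺ c k) (rowOf c b e ks)
  rowOf-All e ks p = All.tabulate λ x∈ → All.lookup (All.map⁺ p) (rowOf-⊆ c b e ks x∈)

  inflated-high : ∀ {k ks} → All (λ l → c l ≺ c k) ks → lookup b k ≡ high i →
                  inflated (k ∷ ks) ≡ attach (c k) (inflated ks)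
  inflated-high {k} {ks} p hi = trans
    (cong₂ inflate (rowOf-accept c b ks hi) (rowOf-reject c b ks λ lo → low≢high {n} i (trans (sym lo) hi)))
    (inflate-upper-∷ʳ (rowOf c b (high i) ks) (rowOf c b (low i) ks) (rowOf-All (low i) ks p))

  inflated-low : ∀ {k ks} → All (λ l → c l ≺ c k) ks → lookup b k ≡ low i →
                 inflated (k ∷ ks) ≡ inflated ks ∷ʳ that (c k)
  inflated-low {k} {ks} p lo = trans
    (cong₂ inflate (rowOf-reject c b ks λ hi → low≢high {n} i (trans (sym lo) hi)) (rowOf-accept c b ks lo))
    (inflate-lower-∷ʳ (rowOf c b (high i) ks) (rowOf c b (low i) ks) (rowOf-All (high i) ks p))

  -- Each constructor of `Unmatched` matches one way in which the inflation grows: `close` appends a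
  -- `that` column, `open-free` adds an entry over an empty cell, and `open-pair` fills the leftmost
  -- `that` column. That column need not belong to the nearest closing bracket, which is why the
  -- invariant records only how many such columns remain. The reversal appears because positions
  -- further left have larger cells.
  inflated-unmatched : ∀ {ks p us} → Unmatched i b ks p us → AllPairs (λ k l → c l ≺ c k) ks →
    overEmpties (inflated ks) ≡ reverse (map c us) × length (underEmpties (inflated ks)) ≡ p
  inflated-unmatched [] [] = refl , refl
  inflated-unmatched (other {k} {ks} ¬hi ¬lo u) (_ ∷ ds)
    rewrite rowOf-reject c b ks ¬hi | rowOf-reject c b ks ¬lo = inflated-unmatched u ds
  inflated-unmatched (close {k} {ks} lo u) (d ∷ ds) with inflated-unmatched u ds
  ... | oe , ue rewrite inflated-low d lo =
    trans (mapMaybe-++ overEmpty (inflated ks) _) (trans (++-identityʳ _) oe) ,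
    trans (cong length (mapMaybe-++ underEmpty (inflated ks) _))
      (trans (List.length-++ (underEmpties (inflated ks))) (trans (ℕ.+-comm _ 1) (cong suc ue)))
  inflated-unmatched (open-free {k} {ks} {us} hi u) (d ∷ ds) with inflated-unmatched u ds
  ... | oe , ue rewrite inflated-high d hi with attach-free (c k) (inflated ks) ue
  ...   | oe′ , ue′ = trans oe′ (trans (cong (_∷ʳ c k) oe) (sym (unfold-reverse (c k) (map c us)))) , ue′
  inflated-unmatched (open-pair {k} {ks} hi u) (d ∷ ds) with inflated-unmatched u ds
  ... | oe , ue rewrite inflated-high d hi with attach-pair (c k) (inflated ks) ue
  ...   | oe′ , ue′ = trans oe′ oe , ue′

-- The operator on tabloids and the crystal isomorphism.

largest-∷ʳ : ∀ {x} xs → All (_≺ x) xs → largest (xs ∷ʳ x) ≡ just x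
largest-∷ʳ []           []          = refl
-- The head `y` is the default value of `max`, so it needs a bound of its own.
largest-∷ʳ {x} (y ∷ ys) (y≺x ∷ ys≺x) = cong just (Extrema.max≈v⁺ ≼.totalOrder
  (∈-++⁺ʳ ys (here refl)) (All.++⁺ (All.map inj₁ ys≺x) (inj₂ refl ∷ [])) (inj₁ y≺x))

-- Inclusions suffice for describing the moved rows, because the final comparison of tabloids goes
-- through `rows-⊆⇒≈`.
moveDown-lower-⊇ : ∀ x cs → lower cs ⊆ lower (map (moveDown x) cs)
moveDown-lower-⊇ x (that y ∷ cs)    (here refl) = here refl
moveDown-lower-⊇ x (that y ∷ cs)    (there z∈)  = there (moveDown-lower-⊇ x cs z∈)
moveDown-lower-⊇ x (these a y ∷ cs) (here refl) = here refl
moveDown-lower-⊇ x (these a y ∷ cs) (there z∈)  = there (moveDown-lower-⊇ x cs z∈)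
moveDown-lower-⊇ x (this a ∷ cs)    z∈ with a ≟ᶜ x
... | yes _ = there (moveDown-lower-⊇ x cs z∈)
... | no  _ = moveDown-lower-⊇ x cs z∈

moveDown-upper-⊇ : ∀ {x y} cs → y ≢ x → y ∈ upper cs → y ∈ upper (map (moveDown x) cs)
moveDown-upper-⊇ (that y ∷ cs)    y≢x y∈          = moveDown-upper-⊇ cs y≢x y∈
moveDown-upper-⊇ (these a y ∷ cs) y≢x (here refl) = here refl
moveDown-upper-⊇ (these a y ∷ cs) y≢x (there y∈)  = there (moveDown-upper-⊇ cs y≢x y∈)
moveDown-upper-⊇ {x} (this a ∷ cs) y≢x y∈ with a ≟ᶜ x
moveDown-upper-⊇ (this a ∷ cs) y≢x (here refl) | yes a≡x = contradiction a≡x y≢x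
moveDown-upper-⊇ (this a ∷ cs) y≢x (there y∈)  | yes _   = moveDown-upper-⊇ cs y≢x y∈
moveDown-upper-⊇ (this a ∷ cs) y≢x (here refl) | no _    = here refl
moveDown-upper-⊇ (this a ∷ cs) y≢x (there y∈)  | no _    = there (moveDown-upper-⊇ cs y≢x y∈)

moveDown-moved : ∀ {x} cs → x ∈ overEmpties cs → x ∈ lower (map (moveDown x) cs)
moveDown-moved (that y ∷ cs)    x∈ = there (moveDown-moved cs x∈)
moveDown-moved (these a y ∷ cs) x∈ = there (moveDown-moved cs x∈)
moveDown-moved {x} (this a ∷ cs) x∈ with a ≟ᶜ x
moveDown-moved (this a ∷ cs) x∈         | yes refl = here refl
moveDown-moved (this a ∷ cs) (here x≡a) | no a≢x   = contradiction (sym x≡a) a≢x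
moveDown-moved (this a ∷ cs) (there x∈) | no _     = moveDown-moved cs x∈

module _ {γ : Composition n} (i : Fin (pred n)) (T : CT γ) where

  private
    columns : Columns
    columns = inflation i T

    lowRow highRow : List ColoredLetter
    lowRow  = lookup (rows T) (low i)
    highRow = lookup (rows T) (high i)

  lower-inflation : lowRow ⊆ lower columns
  lower-inflation x∈ = ∈-resp-↭ (↭-sym (places-lower (map this highRow) lowRow)) (∈-++⁺ˡ x∈)

  upper-inflation : upper columns ≡ highRow
  upper-inflation = trans (places-upper (map this highRow) lowRow) (upper-this highRow)

  movedDown : ColoredLetter → CT γ
  movedDown x = mkCT (moveDown-rows i x T) (moveDown-isTabloid i x T)

  private
    lowered : ColoredLetter → Filling n
    lowered x = rows T [ low i ]≔ lower (map (moveDown x) columns)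

  movedDown-high : ∀ x → lookup (rows (movedDown x)) (high i) ≡ upper (map (moveDown x) columns)
  movedDown-high x = lookup∘update (high i) (lowered x) (upper (map (moveDown x) columns))

  movedDown-≢high : ∀ x {e} → e ≢ high i → lookup (rows (movedDown x)) e ≡ lookup (lowered x) e
  movedDown-≢high x e≢high = lookup∘update′ e≢high (lowered x) (upper (map (moveDown x) columns))

  movedDown-low : ∀ x → lookup (rows (movedDown x)) (low i) ≡ lower (map (moveDown x) columns)
  movedDown-low x = trans (movedDown-≢high x (low≢high {n} i))
    (lookup∘update (low i) (rows T) (lower (map (moveDown x) columns)))

  movedDown-∋ : ∀ {x} → x ∈ overEmpties columns → x ∈ lookup (rows (movedDown x)) (low i)
  movedDown-∋ {x} x∈ = subst (x ∈_) (sym (movedDown-low x)) (moveDown-moved columns x∈)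

  movedDown-⊇ : ∀ {x y e} → y ≢ x → y ∈ lookup (rows T) e → y ∈ lookup (rows (movedDown x)) e
  movedDown-⊇ {x} {y} {e} y≢x y∈ with e Fin.≟ high i
  ... | yes refl = subst (y ∈_) (sym (movedDown-high x))
    (moveDown-upper-⊇ columns y≢x (subst (y ∈_) (sym upper-inflation) y∈))
  ... | no e≢high with e Fin.≟ low i
  ...   | yes refl = subst (y ∈_) (sym (movedDown-low x)) (moveDown-lower-⊇ x columns (lower-inflation y∈))
  ...   | no e≢low = subst (y ∈_) (sym (trans (movedDown-≢high x e≢high)
    (lookup∘update′ e≢low (rows T) (lower (map (moveDown x) columns))))) y∈

  e†-largest : ∀ {x} → largest (overEmpties columns) ≡ just x → e† i T ≡ just (movedDown x)
  e†-largest eq = cong (Maybe.map movedDown) eq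

  e†-nothing⁺ : overEmpties columns ≡ [] → e† i T ≡ nothing
  e†-nothing⁺ eq = cong (Maybe.map movedDown ∘ largest) eq

  e†-nothing⁻ : e† i T ≡ nothing → overEmpties columns ≡ []
  e†-nothing⁻ eq with overEmpties columns
  ... | []    = refl
  e†-nothing⁻ () | _ ∷ _

module _ (γ : Composition n) (b : Word n) (i : Fin (pred n)) where

  overEmpties-𝔠 : ∀ {p us} → Unmatched i b (allFin n) p us →
                  overEmpties (inflation i (𝔠 γ b)) ≡ reverse (map (cell γ) us)
  overEmpties-𝔠 u = trans (cong overEmpties (cong₂ inflate (row-𝔠 γ b (high i)) (row-𝔠 γ b (low i))))
    (proj₁ (inflated-unmatched i b (cell γ) u (cell-decreasing γ)))

  -- Rewriting the letter at `k` sends the single colored letter `cell γ k` to row `low i`. Any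
  -- other position keeps its row on both sides, its cell being different by `cell-injective`.
  𝔠-update : ∀ {k} → cell γ k ∈ overEmpties (inflation i (𝔠 γ b)) →
             𝔠 γ (b [ k ]≔ low i) ≈ movedDown i (𝔠 γ b) (cell γ k)
  𝔠-update {k} k∈ = rows-⊆⇒≈ (𝔠 γ b′) (movedDown i (𝔠 γ b) (cell γ k)) 𝔠b′⊆
    where
    b′ = b [ k ]≔ low i
    𝔠b′⊆ : ∀ e → lookup (rows (𝔠 γ b′)) e ⊆ lookup (rows (movedDown i (𝔠 γ b) (cell γ k))) e
    𝔠b′⊆ e x∈ with ∈-𝔠⁻ γ b′ x∈
    ... | j , refl , refl with j Fin.≟ k
    ...   | yes refl = subst (λ e → cell γ k ∈ lookup (rows (movedDown i (𝔠 γ b) (cell γ k))) e)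
      (sym (lookup∘update k b (low i))) (movedDown-∋ i (𝔠 γ b) k∈)
    ...   | no j≢k = movedDown-⊇ i (𝔠 γ b) (j≢k ∘ cell-injective γ)
      (subst (λ e → cell γ j ∈ lookup (rows (𝔠 γ b)) e) (sym (lookup∘update′ j≢k b (low i))) (∈-𝔠⁺ γ b j))

  𝔠-ẽ : Pointwise _≈_ (Maybe.map (𝔠 γ) (ẽ i b)) (e† i (𝔠 γ b))
  𝔠-ẽ with unmatched-total i b (allFin n)
  ... | p , [] , u = subst₂ (Pointwise _≈_)
    (cong (Maybe.map (𝔠 γ)) (sym (ẽ-nothing i b (unmatched-opens i b u))))
    (sym (e†-nothing⁺ i (𝔠 γ b) (overEmpties-𝔠 u)))
    nothing
  -- Here `k` is the leftmost unmatched opening bracket, so its cell is the largest entry over an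
  -- empty cell, and both operators act on the same letter.
  ... | p , k ∷ us , u = subst₂ (Pointwise _≈_)
    (cong (Maybe.map (𝔠 γ)) (sym (ẽ-just i b (unmatched-opens i b u)
      (AllPairs.head (unmatched-AllPairs i b u (allFin⁺ n))) (All.tail (unmatched-high i b u)))))
    (sym (e†-largest i (𝔠 γ b) (trans (cong largest overEmpties≡) (largest-∷ʳ (reverse (map (cell γ) us)) below))))
    (just (𝔠-update (subst (cell γ k ∈_) (sym overEmpties≡) (∈-++⁺ʳ _ (here refl)))))
    where
    overEmpties≡ : overEmpties (inflation i (𝔠 γ b)) ≡ reverse (map (cell γ) us) ∷ʳ cell γ k
    overEmpties≡ = trans (overEmpties-𝔠 u) (unfold-reverse (cell γ k) (map (cell γ) us))
    below : All (_≺ cell γ k) (reverse (map (cell γ) us))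
    below = All-resp-↭ (↭-sym (↭-reverse _))
      (All.map⁺ (AllPairs.head (unmatched-AllPairs i b u (cell-decreasing γ))))

-- Highest weight elements.

Below : List ColoredLetter → List ColoredLetter → Set
Below = Prefix (flip _≺_)

-- A cell under an entry smaller than all arriving ones is never filled.
places-skip : ∀ {a} cs es → All (a ≺_) es → foldl place (this a ∷ cs) es ≡ this a ∷ foldl place cs es
places-skip cs []       []           = refl
places-skip {a} cs (e ∷ es) (a≺e ∷ a≺es) with a ≺? e
... | yes _   = places-skip (place cs e) es a≺es
... | no  a⊀e = contradiction a≺e a⊀e

places-these : ∀ {a y} cs es → foldl place (these a y ∷ cs) es ≡ these a y ∷ foldl place cs es
places-these cs []       = refl
places-these cs (e ∷ es) = places-these (place cs e) es

place-overEmpties-[] : ∀ cs e → overEmpties cs ≡ [] → overEmpties (place cs e) ≡ []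
place-overEmpties-[] []               e eq = refl
place-overEmpties-[] (that y ∷ cs)    e eq = place-overEmpties-[] cs e eq
place-overEmpties-[] (these a y ∷ cs) e eq = place-overEmpties-[] cs e eq

places-overEmpties-[] : ∀ cs es → overEmpties cs ≡ [] → overEmpties (foldl place cs es) ≡ []
places-overEmpties-[] cs []       eq = eq
places-overEmpties-[] cs (e ∷ es) eq = places-overEmpties-[] (place cs e) es (place-overEmpties-[] cs e eq)

-- The first lower entry goes under the first upper one; this column is then complete, and the
-- remaining entries inflate independently of it.
Below⇒full : ∀ {as es} → Below as es → overEmpties (inflate as es) ≡ []
Below⇒full {es = es} [] = places-overEmpties-[] [] es refl
Below⇒full {a ∷ as} {e ∷ es} (e≺a ∷ p) with a ≺? e
... | yes a≺e = contradiction a≺e (≺-asym e≺a)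
... | no  _   = trans (cong overEmpties (places-these (map this as) es)) (Below⇒full p)

-- The first lower entry `e` decides the first column: it either fills the cell under `a` or is
-- larger than `a`. Disjointness rules out equality, making the comparison strict when `e` does fill
-- the cell.
full⇒Below : ∀ {as es} → AllPairs _≺_ es → (∀ {x} → x ∈ as → ¬ x ∈ es) →
             overEmpties (inflate as es) ≡ [] → Below as es
full⇒Below {[]}            _        _        _  = []
full⇒Below {a ∷ as} {e ∷ es} (e≺es ∷ p) disjoint eq with a ≺? e
... | no a⊀e = ≺-connex a⊀e (λ { refl → disjoint (here refl) (here refl) })
  ∷ full⇒Below p (λ x∈as x∈es → disjoint (there x∈as) (there x∈es))
      (trans (cong overEmpties (sym (places-these (map this as) es))) eq)
-- All later entries exceed `e` and hence `a`, so the cell under `a` would stay empty, against `eq`.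
... | yes a≺e with () ← trans
  (sym (cong overEmpties (places-skip (place (map this as) e) es (All.map (≺-trans a≺e) e≺es)))) eq

Below-lookup : ∀ {as es} → Below as es → ∀ c c′ → toℕ c ≡ toℕ c′ → List.lookup es c ≺ List.lookup as c′
Below-lookup (e≺a ∷ p) zero    zero     eq = e≺a
Below-lookup (e≺a ∷ p) (suc c) (suc c′) eq = Below-lookup p c c′ (ℕ.suc-injective eq)

lookup-Below : ∀ as es → length as ℕ.≤ length es →
               (∀ c c′ → toℕ c ≡ toℕ c′ → List.lookup es c ≺ List.lookup as c′) → Below as es
lookup-Below []       es       _         _ = []
lookup-Below (a ∷ as) (e ∷ es) (s≤s len) f =
  f zero zero refl ∷ lookup-Below as es len (λ c c′ eq → f (suc c) (suc c′) (cong suc eq))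

-- `Prefix` also requires the lower row to be at least as long as the upper one. This is what makes
-- the relation compose: a shorter row in the middle would leave some cells of the outer rows
-- uncompared.
Below-trans : ∀ {as bs cs} → Below as bs → Below bs cs → Below as cs
Below-trans = Prefix.trans (λ b≺a c≺b → ≺-trans c≺b b≺a)

low<high : (i : Fin (pred n)) → low {n} i Fin.< high {n} i
low<high {suc n} i = s≤s (ℕ.≤-reflexive (Fin.toℕ-inject₁ i))

consecutive⇒all : ∀ {R : Rel A 0ℓ} → (∀ {x y z} → R x y → R y z → R x z) → (v : Vec A n) →
                  (∀ i → R (lookup v (low i)) (lookup v (high i))) →
                  ∀ {r r′} → r Fin.< r′ → R (lookup v r) (lookup v r′)
consecutive⇒all {n = suc (suc n)} {R = R} tr (x ∷ y ∷ v) adj {zero} {suc zero} _ = adj zero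
consecutive⇒all {n = suc (suc n)} {R = R} tr (x ∷ y ∷ v) adj {zero} {suc (suc r′)} _ =
  tr (adj zero) (consecutive⇒all {R = R} tr (y ∷ v) (adj ∘ suc) {zero} {suc r′} (s≤s z≤n))
consecutive⇒all {n = suc (suc n)} {R = R} tr (x ∷ y ∷ v) adj {suc r} {suc r′} (s≤s r<r′) =
  consecutive⇒all {R = R} tr (y ∷ v) (adj ∘ suc) r<r′

module _ {γ : Composition n} (T : CT γ) where

  HighestWeight⇒Below : HighestWeight T → ∀ i → Below (lookup (rows T) (high i)) (lookup (rows T) (low i))
  HighestWeight⇒Below hw i = full⇒Below (Linked⇒AllPairs ≺-trans (CT.increasing T (low i)))
    (λ x∈high x∈low → low≢high {n} i (row-unique T x∈low x∈high)) (e†-nothing⁻ i T (hw i))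

  -- Each operator controls two adjacent rows only; transitivity of `Below` carries the comparison
  -- to rows further apart.
  HighestWeight⇒ColumnsIncrease : HighestWeight T → ColumnsIncrease T
  HighestWeight⇒ColumnsIncrease hw {r} {r′} r<r′ = Below-lookup
    (consecutive⇒all {R = flip Below} (λ p q → Below-trans q p) (rows T) (HighestWeight⇒Below hw) r<r′)

  -- `ColumnsIncrease` says nothing about the part of a row that overhangs the row beneath it. The
  -- bound on lengths excludes such a part; it is supplied by the parts of a partition being weakly
  -- decreasing.
  ColumnsIncrease⇒HighestWeight : (∀ i → length (lookup (rows T) (high i)) ℕ.≤ length (lookup (rows T) (low i))) →
                                  ColumnsIncrease T → HighestWeight T
  ColumnsIncrease⇒HighestWeight len ci i = e†-nothing⁺ i T (Below⇒full (lookup-Below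
    (lookup (rows T) (high i)) (lookup (rows T) (low i)) (len i) (ci {low i} {high i} (low<high {n} i))))

consecutive-≥ : ∀ {v : Vec ℕ n} → Linked ℕ._≥_ v → ∀ i → lookup v (high i) ℕ.≤ lookup v (low i)
consecutive-≥ {v = x ∷ y ∷ v} (p ∷ ps) zero    = p
consecutive-≥ {v = x ∷ y ∷ v} (p ∷ ps) (suc i) = consecutive-≥ ps i

theorem37 : (n : ℕ) (γ : Composition n) →
  ( Bijective _≡_ _≈_ (𝔠 γ)
  × ((b : Word n) → wt (𝔠 γ b) ≡ wtʷ b)
  × ((b : Word n) (i : Fin (pred n)) →
      Pointwise _≈_ (Maybe.map (𝔠 γ) (ẽ i b)) (e† i (𝔠 γ b)))
  ) ×
  ( (μ : Partition n) →
      (λ (T : CT γ) → HighestWeight T × wt T ≡ Partition.parts μ)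
      ≐ (λ (T : CT γ) → shape T ≡ Partition.parts μ × ColumnsIncrease T)
  )
theorem37 n γ = (𝔠-bijective γ , 𝔠-wt γ , 𝔠-ẽ γ) , λ μ →
    (λ {T} (hw , wt≡μ) → wt≡μ , HighestWeight⇒ColumnsIncrease T hw)
  , (λ {T} (shape≡μ , ci) → ColumnsIncrease⇒HighestWeight T (decreasing μ T shape≡μ) ci , shape≡μ)
  where
  decreasing : ∀ μ (T : CT γ) → shape T ≡ Partition.parts μ →
               ∀ i → length (lookup (rows T) (high i)) ℕ.≤ length (lookup (rows T) (low i))
  decreasing μ T shape≡μ i = subst₂ ℕ._≤_
    (Vec.lookup-map (high i) length (rows T)) (Vec.lookup-map (low i) length (rows T))
    (consecutive-≥ (subst (Linked ℕ._≥_) (sym shape≡μ) (Partition.decreasing μ)) i)
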